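{- Let $x_1,x_2,x_3,x_4$ be prime numbers and let $a,b$ be positive integers such that (i) $x_1+x_2+x_3+x_4=a^2$; (ii) $\sum_{i=1}^{4}\mathrm{dgs}(x_i)=b^2$; (iii) $\mathrm{dgs}(a^2)+\mathrm{dgs}(b^2)=\mathrm{dgs}(a^2+b^2)$; (iv) $a^2+b^2$ is a prime of the form $4s+1$ for some positive integer $s$. Then $b\neq 4$.
   Context: For a positive integer $n$, $\mathrm{dgs}(n)$ denotes the sum of all digits of $n$ in its decimal representation. The primes $x_1,\dots,x_4$ need not be distinct. -}

module Defs where

open import Data.Digit using (toDigits)
open import Data.Fin.Base using (toℕ)
open import Data.List.Base using (map)
open import Data.Nat.Base using (ℕ)
open import Data.Nat.ListAction using (sum)
open import Data.Product.Base using (proj₁)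

dgs : ℕ → ℕ
dgs n = sum (map toℕ (proj₁ (toDigits 10 n)))

module Submission where

-- A prime has a nonzero units digit. Condition (iii) for b = 4 says that adding 16 to the odd
-- square a² produces no carry, so a² ends in 1; since the digits of the xᵢ sum to 16, their
-- units digits must sum to 11, which leaves digit sum 5 for the rest. Hence a² = 11 + 10 m with
-- m a sum of five powers of ten, and a² ≡ 1 (mod 8) determines how many of these are 1 and 10:
-- a² is one of 121 + 3 powers, 321 + 1 power, 41 + 2 powers, or 241, all powers being at least
-- 1000. A sieve over residue classes of the exponents excludes each of them. For 121 no
-- congruence on a² modulo numbers prime to 10 can do so, because 121 + 10⁰ + 10² + 10⁻² is the
-- square of 149/10. But 149² + 1600 = 23801 is prime, so for exponents congruent to 0, 2, −2
-- modulo the order of 10 modulo 23801 the number a² + 16 is divisible by 23801, hence not prime.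

open import Defs
open import Algebra.Properties.CommutativeSemiring.Binomial using (theorem)
open import Data.Digit using (Digit; fromDigits; toDigits)
open import Data.Fin.Base using (zero; suc; toℕ; fromℕ; fromℕ<; inject₁)
open import Data.Fin.Properties using (toℕ<n; toℕ-fromℕ; toℕ-fromℕ<; toℕ-inject₁)
open import Data.List.Base
  using (List; []; _∷_; _++_; map; length; replicate; upTo; concatMap; cartesianProductWith; filter)
open import Data.List.Membership.Propositional using (_∈_; lose)
open import Data.List.Membership.Propositional.Properties
  using (∈-filter⁺; ∈-upTo⁺; ∈-cartesianProductWith⁺; ∈-concatMap⁺)
open import Data.List.Properties using (map-++; length-++; length-map; length-replicate)
open import Data.List.Relation.Binary.Pointwise.Base using (Pointwise; []; _∷_)
open import Data.List.Relation.Unary.All as All using (All; []; _∷_; all?)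
open import Data.List.Relation.Unary.Any using (here)
open import Data.Nat.Base
open import Data.Nat.Combinatorics
  using (_C_; nCn≡1; nC1≡n; nCk+nC[k+1]≡[n+1]C[k+1]; k>n⇒nCk≡0)
open import Data.Nat.Divisibility
open import Data.Nat.DivMod
open import Data.Nat.ListAction using (sum)
open import Data.Nat.ListAction.Properties using (sum-++)
open import Data.Nat.Primality
  using (Prime; prime?; prime⇒nonZero; prime⇒irreducible; euclidsLemma; ¬prime[1])
open import Data.Nat.Properties
open import Data.Nat.Tactic.RingSolver using (solve-∀)
open import Data.Product.Base using (∃; ∃-syntax; _×_; _,_; proj₁; proj₂)
open import Data.Product.Properties using (≡-dec)
open import Data.Sum.Base using (inj₁; inj₂; [_,_]′)
open import Data.Unit.Base using (⊤; tt)
open import Data.Vec.Functional using (Vector)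
open import Function.Base using (id; _∘_)
open import Relation.Binary.PropositionalEquality
open import Relation.Nullary.Decidable
  using (Dec; yes; no; True; toWitness; from-yes; from-no; _×-dec_; _→-dec_; ¬?)
open import Relation.Nullary.Negation using (contradiction)
open import Relation.Unary using (Decidable)
import Algebra.Properties.CommutativeMonoid.Sum +-0-commutativeMonoid as Σ
import Algebra.Properties.Semiring.Exp +-*-semiring as Exp
import Algebra.Properties.Semiring.Mult +-*-semiring as Mult
import Data.List.Membership.DecPropositional (≡-dec _≟_ _≟_) as DecMembership

-- Fermat's little theorem

-- Absorption identity, by induction on n with Pascal's rule. It exposes the factor n + 1 needed in
-- `prime∣C`.
[k+1]*[n+1]C[k+1]≡[n+1]*nCk : ∀ n k → suc k * (suc n C suc k) ≡ suc n * (n C k)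
[k+1]*[n+1]C[k+1]≡[n+1]*nCk n zero =
  trans (*-identityˡ (suc n C 1)) (trans (nC1≡n (suc n)) (sym (*-identityʳ (suc n))))
[k+1]*[n+1]C[k+1]≡[n+1]*nCk zero (suc k) =
  trans (cong (suc (suc k) *_) (k>n⇒nCk≡0 {1} {suc (suc k)} (s<s z<s))) (*-zeroʳ (suc (suc k)))
[k+1]*[n+1]C[k+1]≡[n+1]*nCk (suc n) (suc k) = begin
  suc (suc k) * (suc (suc n) C suc (suc k))
    ≡⟨ cong (suc (suc k) *_) (nCk+nC[k+1]≡[n+1]C[k+1] (suc n) (suc k)) ⟨
  suc (suc k) * (x + y)
    ≡⟨ *-distribˡ-+ (suc (suc k)) x y ⟩
  (x + suc k * x) + suc (suc k) * y
    ≡⟨ cong₂ (λ l r → x + l + r)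
         ([k+1]*[n+1]C[k+1]≡[n+1]*nCk n k) ([k+1]*[n+1]C[k+1]≡[n+1]*nCk n (suc k)) ⟩
  (x + suc n * (n C k)) + suc n * (n C suc k)
    ≡⟨ +-assoc x _ _ ⟩
  x + (suc n * (n C k) + suc n * (n C suc k))
    ≡⟨ cong (x +_) (*-distribˡ-+ (suc n) (n C k) (n C suc k)) ⟨
  x + suc n * (n C k + n C suc k)
    ≡⟨ cong (λ z → x + suc n * z) (nCk+nC[k+1]≡[n+1]C[k+1] n k) ⟩
  suc (suc n) * x ∎
  where
  open ≡-Reasoning
  x = suc n C suc k
  y = suc n C suc (suc k)

-- By absorption the prime divides `suc k * (suc n C suc k)`, and it is too large to divide `suc k`.
prime∣C : ∀ {n} k → Prime (suc n) → k < n → suc n ∣ suc n C suc k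
prime∣C {n} k pr k<n =
  [ (λ p∣k → contradiction (∣⇒≤ p∣k) (<⇒≱ (s<s k<n))) , id ]′
    (euclidsLemma (suc k) (suc n C suc k) pr
      (subst (suc n ∣_) (sym ([k+1]*[n+1]C[k+1]≡[n+1]*nCk n k)) (m∣m*n _)))

-- The binomial theorem for semirings uses their generic power; this translates it to the power on
-- ℕ.
exp≡^ : ∀ x n → x Exp.^ n ≡ x ^ n
exp≡^ x zero    = refl
exp≡^ x (suc n) = cong (x *_) (exp≡^ x n)

∣⇒∣× : ∀ {d n} x → d ∣ n → d ∣ n Mult.× x
∣⇒∣× {d} {n} x d∣n = subst (d ∣_) (sym (×≡* n)) (∣m⇒∣m*n x d∣n)
  where
  ×≡* : ∀ n → n Mult.× x ≡ n * x
  ×≡* zero    = refl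
  ×≡* (suc n) = cong (x +_) (×≡* n)

∣-sum : ∀ {d n} (f : Vector ℕ n) → (∀ i → d ∣ f i) → d ∣ Σ.sum f
∣-sum {n = zero}  f h = _ ∣0
∣-sum {n = suc n} f h = ∣m∣n⇒∣m+n (h zero) (∣-sum (f ∘ suc) (h ∘ suc))

-- In the binomial expansion every term but the first and the last is a multiple of p.
[a+1]^p%p≡[a^p+1]%p : ∀ p .{{_ : NonZero p}} → Prime p → ∀ a → (a + 1) ^ p % p ≡ (a ^ p + 1) % p
[a+1]^p%p≡[a^p+1]%p p@(suc n) pr a = begin
  (a + 1) ^ p % p                 ≡⟨ cong (_% p) (exp≡^ (a + 1) p) ⟨
  (a + 1) Exp.^ p % p             ≡⟨ cong (_% p) (theorem +-*-commutativeSemiring p a 1) ⟩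
  Σ.sum f % p                     ≡⟨ cong (_% p) (cong (f zero +_) (Σ.sum-init-last (f ∘ suc))) ⟩
  (f zero + (inner + f (fromℕ p))) % p ≡⟨ cong (_% p) (reorder (f zero) inner (f (fromℕ p))) ⟩
  (inner + (f (fromℕ p) + f zero)) % p ≡⟨ %-remove-+ˡ _ (∣-sum (f ∘ suc ∘ inject₁) p∣term) ⟩
  (f (fromℕ p) + f zero) % p      ≡⟨ cong₂ (λ l r → (l + r) % p) last≡ first≡ ⟩
  (a ^ p + 1) % p                 ∎
  where
  open ≡-Reasoning
  reorder : ∀ x y z → x + (y + z) ≡ y + (z + x)
  reorder = solve-∀
  f : Vector ℕ (suc p)
  f k = (p C toℕ k) Mult.× (a Exp.^ toℕ k * 1 Exp.^ (p ∸ toℕ k))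
  inner = Σ.sum (f ∘ suc ∘ inject₁)
  p∣term : ∀ i → p ∣ f (suc (inject₁ i))
  p∣term i = ∣⇒∣× _ (prime∣C (toℕ (inject₁ i)) pr (subst (_< n) (sym (toℕ-inject₁ i)) (toℕ<n i)))
  1^ : ∀ m → 1 Exp.^ m ≡ 1
  1^ m = trans (exp≡^ 1 m) (^-zeroˡ m)
  first≡ : f zero ≡ 1
  first≡ = trans (+-identityʳ _) (trans (+-identityʳ _) (1^ p))
  last≡ : f (fromℕ p) ≡ a ^ p
  last≡ = begin
    f (fromℕ p) ≡⟨ cong (λ k → (p C k) Mult.× (a Exp.^ k * 1 Exp.^ (p ∸ k))) (toℕ-fromℕ p) ⟩
    (p C p) Mult.× (a Exp.^ p * 1 Exp.^ (p ∸ p))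
      ≡⟨ cong₂ Mult._×_ (nCn≡1 p) (cong₂ _*_ (exp≡^ a p) (1^ (p ∸ p))) ⟩
    a ^ p * 1 + 0 ≡⟨ trans (+-identityʳ _) (*-identityʳ _) ⟩
    a ^ p ∎

fermat : ∀ p .{{_ : NonZero p}} → Prime p → ∀ a → a ^ p % p ≡ a % p
fermat p@(suc _) pr zero = refl
fermat p pr (suc a) = begin
  suc a ^ p % p           ≡⟨ cong (λ b → b ^ p % p) (+-comm a 1) ⟨
  (a + 1) ^ p % p         ≡⟨ [a+1]^p%p≡[a^p+1]%p p pr a ⟩
  (a ^ p + 1) % p         ≡⟨ %-distribˡ-+ (a ^ p) 1 p ⟩
  (a ^ p % p + 1 % p) % p ≡⟨ cong (λ b → (b + 1 % p) % p) (fermat p pr a) ⟩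
  (a % p + 1 % p) % p     ≡⟨ %-distribˡ-+ a 1 p ⟨
  (a + 1) % p             ≡⟨ cong (_% p) (+-comm a 1) ⟩
  suc a % p               ∎
  where open ≡-Reasoning

-- Sieving exponents of powers of ten

module _ (p : ℕ) .{{_ : NonZero p}} where

  open ≡-Reasoning

  +-cong-% : ∀ {a a′ b b′} → a % p ≡ a′ % p → b % p ≡ b′ % p → (a + b) % p ≡ (a′ + b′) % p
  +-cong-% {a} {a′} {b} {b′} a≡ b≡ = begin
    (a + b) % p           ≡⟨ %-distribˡ-+ a b p ⟩
    (a % p + b % p) % p   ≡⟨ cong₂ (λ x y → (x + y) % p) a≡ b≡ ⟩
    (a′ % p + b′ % p) % p ≡⟨ %-distribˡ-+ a′ b′ p ⟨
    (a′ + b′) % p         ∎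

  *-cong-% : ∀ {a a′ b b′} → a % p ≡ a′ % p → b % p ≡ b′ % p → (a * b) % p ≡ (a′ * b′) % p
  *-cong-% {a} {a′} {b} {b′} a≡ b≡ = begin
    (a * b) % p               ≡⟨ %-distribˡ-* a b p ⟩
    ((a % p) * (b % p)) % p   ≡⟨ cong₂ (λ x y → (x * y) % p) a≡ b≡ ⟩
    ((a′ % p) * (b′ % p)) % p ≡⟨ %-distribˡ-* a′ b′ p ⟨
    (a′ * b′) % p             ∎

  ^-cong-% : ∀ {a a′} e → a % p ≡ a′ % p → (a ^ e) % p ≡ (a′ ^ e) % p
  ^-cong-% zero    a≡ = refl
  ^-cong-% {a} {a′} (suc e) a≡ = *-cong-% {a} {a′} a≡ (^-cong-% e a≡)

-- Digits of the exponent in base 4; k bounds their number.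
powMod : (k p : ℕ) .{{_ : NonZero p}} → ℕ → ℕ → ℕ
powMod zero    p b e         = b ^ e % p
powMod (suc k) p b zero      = 1
powMod (suc k) p b e@(suc _) = b ^ (e % 4) * powMod k p (b ^ 4 % p) (e / 4) % p

-- True for every k: once k is used up, the remaining power is computed outright, so a small k costs
-- only time. The left side is reduced again because exponent 0 yields an unreduced 1.
powMod-correct : ∀ k p .{{_ : NonZero p}} b e → powMod k p b e % p ≡ b ^ e % p
powMod-correct zero    p b e         = m%n%n≡m%n (b ^ e) p
powMod-correct (suc k) p b zero      = refl
powMod-correct (suc k) p b e@(suc _) = begin
  b ^ (e % 4) * powMod k p (b ^ 4 % p) (e / 4) % p % p
    ≡⟨ m%n%n≡m%n _ p ⟩
  b ^ (e % 4) * powMod k p (b ^ 4 % p) (e / 4) % p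
    ≡⟨ *-cong-% p {b ^ (e % 4)} refl
         (trans (powMod-correct k p (b ^ 4 % p) (e / 4)) (^-cong-% p (e / 4) (m%n%n≡m%n (b ^ 4) p))) ⟩
  b ^ (e % 4) * (b ^ 4) ^ (e / 4) % p
    ≡⟨ cong (λ x → b ^ (e % 4) * x % p) (trans (^-*-assoc b 4 (e / 4)) (cong (b ^_) (*-comm 4 (e / 4)))) ⟩
  b ^ (e % 4) * b ^ (e / 4 * 4) % p
    ≡⟨ cong (_% p) (^-distribˡ-+-* b (e % 4) (e / 4 * 4)) ⟨
  b ^ (e % 4 + e / 4 * 4) % p
    ≡⟨ cong (λ x → b ^ x % p) (m≡m%n+[m/n]*n e 4) ⟨
  b ^ e % p ∎
  where open ≡-Reasoning

-- The exponent (p+1)/2 instead of (p-1)/2 spares the case distinction p ∣ v.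
euler : ∀ p .{{_ : NonZero p}} → Prime p → p % 2 ≡ 1 → ∀ a v → v % p ≡ a ^ 2 % p →
        v ^ suc (p / 2) % p ≡ v % p
euler p pr odd a v v≡a² = begin
  v ^ suc (p / 2) % p       ≡⟨ ^-cong-% p (suc (p / 2)) v≡a² ⟩
  (a ^ 2) ^ suc (p / 2) % p ≡⟨ cong (_% p) (^-*-assoc a 2 (suc (p / 2))) ⟩
  a ^ (2 * suc (p / 2)) % p ≡⟨ cong (λ e → a ^ e % p) exponent ⟩
  a * a ^ p % p             ≡⟨ *-cong-% p {a} refl (fermat p pr a) ⟩
  a * a % p                 ≡⟨ cong (λ x → a * x % p) (*-identityʳ a) ⟨
  a ^ 2 % p                 ≡⟨ v≡a² ⟨
  v % p                     ∎
  where
  open ≡-Reasoning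
  double : ∀ h → 2 * suc h ≡ suc (1 + h * 2)
  double = solve-∀
  exponent : 2 * suc (p / 2) ≡ suc p
  exponent = begin
    2 * suc (p / 2)           ≡⟨ double (p / 2) ⟩
    suc (1 + p / 2 * 2)       ≡⟨ cong (λ x → suc (x + p / 2 * 2)) odd ⟨
    suc (p % 2 + p / 2 * 2)   ≡⟨ cong suc (m≡m%n+[m/n]*n p 2) ⟨
    suc p                     ∎

-- Tuples of exponents and their residue classes

powersOf10 : List ℕ → ℕ
powersOf10 es = sum (map (10 ^_) es)

InClass : ℕ → List ℕ → List ℕ → Set
InClass N = Pointwise (λ t r → ∃[ u ] t ≡ r + u * N)

lifts : ℕ → ℕ → List ℕ → List (List ℕ)
lifts N q []      = [] ∷ []
lifts N q (r ∷ s) = cartesianProductWith (λ u → (r + u * N) ∷_) (upTo q) (lifts N q s)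

-- Dividing the quotient u by q turns r + u N into (r + (u mod q) N) plus a multiple of q N.
lifts-cover : ∀ {N T s} q .{{_ : NonZero q}} → InClass N T s →
              ∃[ s′ ] s′ ∈ lifts N q s × InClass (q * N) T s′
lifts-cover q [] = [] , here refl , []
lifts-cover {N} {t ∷ _} {r ∷ _} q ((u , t≡) ∷ T∈s) with lifts-cover q T∈s
... | s′ , s′∈ , T∈s′ =
  (r + u % q * N) ∷ s′ ,
  ∈-cartesianProductWith⁺ (λ u → (r + u * N) ∷_) (∈-upTo⁺ (m%n<n u q)) s′∈ ,
  (u / q , t≡′) ∷ T∈s′
  where
  open ≡-Reasoning
  regroup : ∀ r x y q N → r + (x + y * q) * N ≡ r + x * N + y * (q * N)
  regroup = solve-∀
  t≡′ : t ≡ r + u % q * N + u / q * (q * N)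
  t≡′ = begin
    t                               ≡⟨ t≡ ⟩
    r + u * N                       ≡⟨ cong (λ x → r + x * N) (m≡m%n+[m/n]*n u q) ⟩
    r + (u % q + u / q * q) * N     ≡⟨ regroup r (u % q) (u / q) q N ⟩
    r + u % q * N + u / q * (q * N) ∎

powersMod : (p : ℕ) .{{_ : NonZero p}} → List ℕ → ℕ
powersMod p s = sum (map (powMod 10 p 10) s)

-- The order of 10 modulo p divides N, so `10 ^ t` modulo p depends only on t modulo N.
powersMod-correct : ∀ p .{{_ : NonZero p}} {N T s} → 10 ^ N % p ≡ 1 % p → InClass N T s →
                    powersMod p s % p ≡ powersOf10 T % p
powersMod-correct p 10^N≡1 [] = refl
powersMod-correct p {N} {t ∷ T} {r ∷ s} 10^N≡1 ((u , t≡) ∷ T∈s) =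
  +-cong-% p {powMod 10 p 10 r} {10 ^ t} head≡ (powersMod-correct p 10^N≡1 T∈s)
  where
  open ≡-Reasoning
  head≡ : powMod 10 p 10 r % p ≡ 10 ^ t % p
  head≡ = begin
    powMod 10 p 10 r % p      ≡⟨ powMod-correct 10 p 10 r ⟩
    10 ^ r % p                ≡⟨ cong (_% p) (*-identityʳ (10 ^ r)) ⟨
    10 ^ r * 1 % p            ≡⟨ cong (λ x → 10 ^ r * x % p) (^-zeroˡ u) ⟨
    10 ^ r * 1 ^ u % p        ≡⟨ *-cong-% p {10 ^ r} refl (^-cong-% p u 10^N≡1) ⟨
    10 ^ r * (10 ^ N) ^ u % p
      ≡⟨ cong (λ x → 10 ^ r * x % p) (trans (^-*-assoc 10 N u) (cong (10 ^_) (*-comm N u))) ⟩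
    10 ^ r * 10 ^ (u * N) % p ≡⟨ cong (_% p) (^-distribˡ-+-* 10 r (u * N)) ⟨
    10 ^ (r + u * N) % p      ≡⟨ cong (λ x → 10 ^ x % p) t≡ ⟨
    10 ^ t % p                ∎

-- Two necessary conditions on the residue v of a² modulo p: a² + 16 is a prime other than p, and v
-- passes the square test of `euler`.
Admissible : (p : ℕ) .{{_ : NonZero p}} → ℕ → Set
Admissible p v = p ∤ v + 16 × powMod 10 p v (suc (p / 2)) % p ≡ v % p

AdmissibleClass : ℕ → List ℕ → ∃ Prime → Set
AdmissibleClass c s (p , pr) = Admissible p (c + powersMod p s)
  where instance _ = prime⇒nonZero pr

-- A separate function of v, so that evaluation shares the value of v.
admissible? : ∀ p .{{_ : NonZero p}} → Decidable (Admissible p)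
admissible? p v = ¬? (p ∣? v + 16) ×-dec (powMod 10 p v (suc (p / 2)) % p ≟ v % p)

admissibleClass? : ∀ c s → Decidable (AdmissibleClass c s)
admissibleClass? c s (p , pr) = admissible? p (c + powersMod p s)
  where instance _ = prime⇒nonZero pr

-- One sieving step: the modulus of the exponent classes is multiplied by index, and the lifted
-- classes are tested against primes.
record Level : Set where
  constructor _∶_
  field
    index           : ℕ
    .{{index≢0}} : NonZero index
    primes          : List (∃ Prime)

-- Refining the modulus by one small factor at a time lets early primes discard most classes before
-- the next splitting.
sieve : ℕ → ℕ → List Level → List (List ℕ) → List (List ℕ)
sieve c N []             S = S
sieve c N ((q ∶ ps) ∷ ls) S =
  sieve c (q * N) ls (filter (λ s → all? (admissibleClass? c s) ps) (concatMap (lifts N q) S))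

-- As a² + 16 ≡ 17 (mod 40), the last condition ensures p ≢ a² + 16, so that p ∣ a² + 16 is
-- impossible.
Usable : ℕ → ∃ Prime → Set
Usable N (p , pr) = p % 2 ≡ 1 × powMod 10 p 10 N % p ≡ 1 % p × p % 40 ≢ 17
  where instance _ = prime⇒nonZero pr

usable? : ∀ N → Decidable (Usable N)
usable? N (p , pr) = (_ ≟ _) ×-dec (_ ≟ _) ×-dec ¬? (_ ≟ _)

Valid : ℕ → List Level → Set
Valid N []              = ⊤
Valid N ((q ∶ ps) ∷ ls) = All (Usable (q * N)) ps × Valid (q * N) ls

valid? : ∀ N ls → Dec (Valid N ls)
valid? N []              = yes tt
valid? N ((q ∶ ps) ∷ ls) = all? (usable? (q * N)) ps ×-dec valid? (q * N) ls

module _ {a c T} (a²≡ : a ^ 2 ≡ c + powersOf10 T) (a²+16-prime : Prime (a ^ 2 + 16))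
         (a²≡1 : a ^ 2 % 40 ≡ 1) where

  admissible : ∀ {N s} ((p , pr) : ∃ Prime) → Usable N (p , pr) → InClass N T s → AdmissibleClass c s (p , pr)
  admissible {N} {s} (p , pr) (odd , 10^N≡1 , p≢) T∈s =
    (λ p∣v+16 → p∤a²+16 (m%n≡0⇒n∣m _ p (trans (+-cong-% p (sym v≡a²) refl) (n∣m⇒m%n≡0 _ p p∣v+16)))) ,
    trans (powMod-correct 10 p v (suc (p / 2))) (euler p pr odd a v v≡a²)
    where
    instance _ = prime⇒nonZero pr
    v = c + powersMod p s
    v≡a² : v % p ≡ a ^ 2 % p
    v≡a² = trans
      (+-cong-% p {c} refl (powersMod-correct p (trans (sym (powMod-correct 10 p 10 N)) 10^N≡1) T∈s))
      (cong (_% p) (sym a²≡))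
    p∤a²+16 : p ∤ a ^ 2 + 16
    p∤a²+16 p∣ with prime⇒irreducible a²+16-prime p∣
    ... | inj₁ refl = ¬prime[1] pr
    ... | inj₂ p≡   = p≢ (trans (cong (_% 40) p≡) (+-cong-% 40 {a ^ 2} {1} {16} {16} a²≡1 refl))

  -- The class of an actual exponent tuple passes every test, so it has a surviving descendant at
  -- each level; an empty result refutes the equation.
  sieve-sound : ∀ {N s S} ls → Valid N ls → s ∈ S → InClass N T s → ∃[ s′ ] s′ ∈ sieve c N ls S
  sieve-sound [] _ s∈S _ = _ , s∈S
  sieve-sound {N} {s} ((q ∶ ps) ∷ ls) (usable , valid) s∈S T∈s with lifts-cover q T∈s
  ... | s′ , s′∈ , T∈s′ = sieve-sound ls valid
    (∈-filter⁺ (λ s → all? (admissibleClass? c s) ps) (∈-concatMap⁺ (lifts N q) (lose s∈S s′∈))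
      (All.map (λ {x} u → admissible x u T∈s′) usable))
    T∈s′

-- Digit sums and sums of powers of ten

Numeral : Set
Numeral = List (Digit 10)

digitSum : Numeral → ℕ
digitSum ds = sum (map toℕ ds)

digits : ℕ → Numeral
digits n = proj₁ (toDigits 10 n)

fromDigits-digits : ∀ n → fromDigits (digits n) ≡ n
fromDigits-digits n = proj₂ (toDigits 10 n)

digit+q*10%10 : ∀ {d} q → d < 10 → (d + q * 10) % 10 ≡ d
digit+q*10%10 {d} q d<10 = trans ([m+kn]%n≡m%n d q 10) (m<n⇒m%n≡m d<10)

digit+q*10-injective : ∀ {d e q r} → d < 10 → e < 10 → d + q * 10 ≡ e + r * 10 → d ≡ e × q ≡ r
digit+q*10-injective {d} {e} {q} {r} d<10 e<10 eq with
  trans (sym (digit+q*10%10 q d<10)) (trans (cong (_% 10) eq) (digit+q*10%10 r e<10))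
... | refl = refl , *-cancelʳ-≡ q r 10 (+-cancelˡ-≡ d _ _ eq)

-- Numerals of one number differ only in leading zeros: compare digit by digit, reading absent
-- digits as 0.
digitSum-unique : ∀ (ds es : Numeral) → fromDigits ds ≡ fromDigits es → digitSum ds ≡ digitSum es
digitSum-unique [] [] eq = refl
digitSum-unique [] (e ∷ es) eq with digit+q*10-injective {q = 0} z<s (toℕ<n e) eq
... | d≡e , eq′ = cong₂ _+_ d≡e (digitSum-unique [] es eq′)
digitSum-unique (d ∷ ds) [] eq with digit+q*10-injective {r = 0} (toℕ<n d) z<s eq
... | d≡e , eq′ = cong₂ _+_ d≡e (digitSum-unique ds [] eq′)
digitSum-unique (d ∷ ds) (e ∷ es) eq with digit+q*10-injective (toℕ<n d) (toℕ<n e) eq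
... | d≡e , eq′ = cong₂ _+_ d≡e (digitSum-unique ds es eq′)

dgs-digit+q*10 : ∀ {d} q → d < 10 → dgs (d + q * 10) ≡ d + dgs q
dgs-digit+q*10 {d} q d<10 = begin
  dgs (d + q * 10)                     ≡⟨ digitSum-unique (digits (d + q * 10)) (fromℕ< d<10 ∷ digits q) eq ⟩
  toℕ (fromℕ< d<10) + digitSum (digits q) ≡⟨ cong (_+ dgs q) (toℕ-fromℕ< d<10) ⟩
  d + dgs q                            ∎
  where
  open ≡-Reasoning
  eq : fromDigits (digits (d + q * 10)) ≡ toℕ (fromℕ< d<10) + fromDigits (digits q) * 10
  eq = trans (fromDigits-digits _)
         (sym (cong₂ (λ x y → x + y * 10) (toℕ-fromℕ< d<10) (fromDigits-digits q)))

dgs≡%+dgs/ : ∀ n → dgs n ≡ n % 10 + dgs (n / 10)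
dgs≡%+dgs/ n = trans (cong dgs (m≡m%n+[m/n]*n n 10)) (dgs-digit+q*10 (n / 10) (m%n<n n 10))

-- A units digit below 9 grows by one; a 9 becomes 0 and passes the carry on, which only lowers the
-- digit sum.
dgs-suc-fromDigits : ∀ (ds : Numeral) → dgs (suc (fromDigits ds)) ≤ suc (digitSum ds)
dgs-suc-fromDigits []       = ≤-refl
dgs-suc-fromDigits (d ∷ ds) with m≤n⇒m<n∨m≡n (toℕ<n d)
... | inj₁ d<9 = ≤-reflexive (trans (dgs-digit+q*10 (fromDigits ds) d<9)
                   (cong (suc (toℕ d) +_) (digitSum-unique (digits (fromDigits ds)) ds (fromDigits-digits _))))
... | inj₂ d≡9 = begin
  dgs (suc (toℕ d) + fromDigits ds * 10) ≡⟨ cong (λ x → dgs (x + fromDigits ds * 10)) d≡9 ⟩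
  dgs (0 + suc (fromDigits ds) * 10)     ≡⟨ dgs-digit+q*10 (suc (fromDigits ds)) z<s ⟩
  dgs (suc (fromDigits ds))              ≤⟨ dgs-suc-fromDigits ds ⟩
  suc (digitSum ds)                      ≤⟨ s≤s (m≤n+m _ (toℕ d)) ⟩
  suc (toℕ d + digitSum ds)              ∎
  where open ≤-Reasoning

dgs-suc : ∀ n → dgs (suc n) ≤ suc (dgs n)
dgs-suc n = subst (λ m → dgs (suc m) ≤ suc (dgs n)) (fromDigits-digits n) (dgs-suc-fromDigits (digits n))

-- A units digit above 3 makes the addition of 16 carry, which loses digit sum.
dgs-+16⇒%10≤3 : ∀ n → dgs n + 7 ≡ dgs (n + 16) → n % 10 ≤ 3
dgs-+16⇒%10≤3 n eq with n % 10 ≤? 3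
... | yes d≤3 = d≤3
... | no  d≰3 = contradiction (sym eq) (<⇒≢ (begin-strict
  dgs (n + 16)                   ≡⟨ cong dgs n+16≡ ⟩
  -- The bound on this digit sum is `dgs n` - 2, which is 9 short of `dgs n + 7`.
  dgs (d-4 + suc (suc q) * 10)   ≡⟨ dgs-digit+q*10 (suc (suc q)) (≤-<-trans (m∸n≤m (n % 10) 4) (m%n<n n 10)) ⟩
  d-4 + dgs (suc (suc q))        ≤⟨ +-monoʳ-≤ d-4 (≤-trans (dgs-suc (suc q)) (s≤s (dgs-suc q))) ⟩
  d-4 + suc (suc (dgs q))        <⟨ m<m+n _ (z<s {8}) ⟩
  d-4 + suc (suc (dgs q)) + 9    ≡⟨ regroup d-4 (dgs q) ⟩
  4 + d-4 + dgs q + 7            ≡⟨ cong (λ x → x + dgs q + 7) d≡ ⟩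
  n % 10 + dgs q + 7             ≡⟨ cong (_+ 7) (dgs≡%+dgs/ n) ⟨
  dgs n + 7                      ∎))
  where
  open ≤-Reasoning
  q = n / 10
  d-4 = n % 10 ∸ 4
  d≡ : 4 + d-4 ≡ n % 10
  d≡ = m+[n∸m]≡n (≰⇒> d≰3)
  regroup : ∀ d s → d + suc (suc s) + 9 ≡ 4 + d + s + 7
  regroup = solve-∀
  regroup′ : ∀ d q → 4 + d + q * 10 + 16 ≡ d + suc (suc q) * 10
  regroup′ = solve-∀
  n+16≡ : n + 16 ≡ d-4 + suc (suc q) * 10
  n+16≡ = trans (cong (_+ 16) (m≡m%n+[m/n]*n n 10))
            (trans (cong (λ x → x + q * 10 + 16) (sym d≡)) (regroup′ d-4 q))

-- Representations as sums of powers of ten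

IsSumOfPowers : ℕ → ℕ → Set
IsSumOfPowers k n = ∃[ es ] length es ≡ k × powersOf10 es ≡ n

powersOf10-++ : ∀ es fs → powersOf10 (es ++ fs) ≡ powersOf10 es + powersOf10 fs
powersOf10-++ es fs = trans (cong sum (map-++ (10 ^_) es fs)) (sum-++ (map (10 ^_) es) _)

+-isSumOfPowers : ∀ {k l m n} → IsSumOfPowers k m → IsSumOfPowers l n → IsSumOfPowers (k + l) (m + n)
+-isSumOfPowers (es , |es| , es≡) (fs , |fs| , fs≡) =
  es ++ fs , trans (length-++ es) (cong₂ _+_ |es| |fs|) , trans (powersOf10-++ es fs) (cong₂ _+_ es≡ fs≡)

powersOf10-shift : ∀ j es → powersOf10 (map (j +_) es) ≡ 10 ^ j * powersOf10 es
powersOf10-shift j []       = sym (*-zeroʳ (10 ^ j))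
powersOf10-shift j (e ∷ es) = trans
  (cong₂ _+_ (^-distribˡ-+-* 10 j e) (powersOf10-shift j es))
  (sym (*-distribˡ-+ (10 ^ j) (10 ^ e) (powersOf10 es)))

replicate-isSumOfPowers : ∀ n → IsSumOfPowers n n
replicate-isSumOfPowers n = replicate n 0 , length-replicate n , value n
  where
  value : ∀ n → powersOf10 (replicate n 0) ≡ n
  value zero    = refl
  value (suc n) = cong suc (value n)

*10-isSumOfPowers : ∀ {k n} → IsSumOfPowers k n → IsSumOfPowers k (n * 10)
*10-isSumOfPowers {n = n} (es , |es| , es≡) =
  map (1 +_) es , trans (length-map (1 +_) es) |es| ,
  trans (powersOf10-shift 1 es) (trans (cong (10 *_) es≡) (*-comm 10 n))

-- A digit d contributes d copies of its place value, so the digit sum counts the powers.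
fromDigits-isSumOfPowers : ∀ (ds : Numeral) → IsSumOfPowers (digitSum ds) (fromDigits ds)
fromDigits-isSumOfPowers []       = [] , refl , refl
fromDigits-isSumOfPowers (d ∷ ds) =
  +-isSumOfPowers (replicate-isSumOfPowers (toℕ d)) (*10-isSumOfPowers (fromDigits-isSumOfPowers ds))

dgs-isSumOfPowers : ∀ n → IsSumOfPowers (dgs n) n
dgs-isSumOfPowers n = subst (IsSumOfPowers (dgs n)) (fromDigits-digits n) (fromDigits-isSumOfPowers (digits n))

-- Here z and o count the exponents 0 and 1, and T holds the others lowered by 2. Only z and o
-- affect 11 + 10 m modulo 1000.
splitLowPowers : ∀ es → ∃[ z ] ∃[ o ] ∃[ T ]
  z + o + length T ≡ length es × powersOf10 es ≡ z + 10 * o + 100 * powersOf10 T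
splitLowPowers [] = 0 , 0 , [] , refl , refl
splitLowPowers (e ∷ es) with splitLowPowers es
splitLowPowers (0 ∷ es) | z , o , T , len , val = suc z , o , T , cong suc len , cong suc val
splitLowPowers (1 ∷ es) | z , o , T , len , val =
  z , suc o , T , trans (cong (_+ length T) (+-suc z o)) (cong suc len) , trans (cong (10 +_) val) (regroup z o _)
  where
  regroup : ∀ z o x → 10 + (z + 10 * o + x) ≡ z + 10 * suc o + x
  regroup = solve-∀
splitLowPowers (2+ t ∷ es) | z , o , T , len , val =
  z , o , t ∷ T , trans (+-suc (z + o) (length T)) (cong suc len) ,
  trans (cong₂ _+_ (^-distribˡ-+-* 10 2 t) val) (regroup z o (10 ^ t) (powersOf10 T))
  where
  regroup : ∀ z o x y → 100 * x + (z + 10 * o + 100 * y) ≡ z + 10 * o + 100 * (x + y)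
  regroup = solve-∀

-- Units digits and the residue of the square modulo 40

prime⇒%10≢0 : ∀ {p} → Prime p → p % 10 ≢ 0
prime⇒%10≢0 {p} pr p%10≡0 with prime⇒irreducible pr (m%n≡0⇒n∣m p 10 p%10≡0)
... | inj₂ refl = contradiction pr (from-no (prime? 10))

-- The bound 4 comes from four nonzero units digits and rules out 1; the bound 16 rules out 21 and
-- beyond.
unitsDigits≡11 : ∀ s → 4 ≤ s → s ≤ 16 → s % 10 ≡ 1 → s ≡ 11
unitsDigits≡11 s 4≤s s≤16 =
  from-yes (allUpTo? (λ s → (4 ≤? s) →-dec (s % 10 ≟ 1) →-dec (s ≟ 11)) 17) (s≤s s≤16) 4≤s

-- Here a is odd, so a² is 1 modulo 8 and ends in 1, 5 or 9; the bound 3 leaves 1. The check runs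
-- over a modulo 40.
square%40≡1 : ∀ a → a ^ 2 % 4 ≡ 1 → a ^ 2 % 10 ≤ 3 → a ^ 2 % 40 ≡ 1
square%40≡1 a %4≡1 %10≤3 = trans (reduce 40 ∣-refl)
  (from-yes (allUpTo? (λ r → (r ^ 2 % 4 ≟ 1) →-dec (r ^ 2 % 10 ≤? 3) →-dec (r ^ 2 % 40 ≟ 1)) 40)
    (m%n<n a 40) (trans (sym (reduce 4 (from-yes (4 ∣? 40)))) %4≡1)
    (subst (_≤ 3) (reduce 10 (from-yes (10 ∣? 40))) %10≤3))
  where
  reduce : ∀ m .{{_ : NonZero m}} → m ∣ 40 → a ^ 2 % m ≡ (a % 40) ^ 2 % m
  reduce m m∣40 = ^-cong-% m 2 (sym (m∣n⇒o%n%m≡o%m m 40 a m∣40))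

-- The exclusion of b = 4

-- These give the constants 121, 321, 41 and 241, with 3, 1, 2 and 0 further powers.
lowPowers : List (ℕ × ℕ)
lowPowers = (1 , 1) ∷ (1 , 3) ∷ (3 , 0) ∷ (3 , 2) ∷ []

lowPowers-complete : ∀ {z} → z < 6 → ∀ {o} → o < 6 → z + o ≤ 5 → (11 + 10 * z + 100 * o) % 40 ≡ 1 →
                     (z , o) ∈ lowPowers
lowPowers-complete = from-yes (allUpTo? (λ z → allUpTo? (λ o →
  (z + o ≤? 5) →-dec ((11 + 10 * z + 100 * o) % 40 ≟ 1) →-dec ((z , o) DecMembership.∈? lowPowers)) 6) 6)

Obstructed : List Level → ℕ × ℕ → Set
Obstructed ls (z , o) = sieve (11 + 10 * z + 100 * o) 1 ls (replicate (5 ∸ (z + o)) 0 ∷ []) ≡ []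

inTrivialClass : ∀ T → InClass 1 T (replicate (length T) 0)
inTrivialClass []      = []
inTrivialClass (t ∷ T) = (t , sym (*-identityʳ t)) ∷ inTrivialClass T

square≢11+10*5powers : ∀ {ls} → Valid 1 ls → All (Obstructed ls) lowPowers →
                       ∀ {a m} → a ^ 2 % 40 ≡ 1 → Prime (a ^ 2 + 16) → IsSumOfPowers 5 m →
                       a ^ 2 ≢ 11 + m * 10
square≢11+10*5powers {ls} valid obstructed {a} {m} a²%40≡1 a²+16-prime (es , |es|≡5 , es≡m) a²≡11+10m
  with splitLowPowers es
... | z , o , T , len , val =
  -- Some class must survive the sieve, yet the computed list is empty.
  contradiction
    (subst (proj₁ survivor ∈_) sieve≡[] (proj₂ survivor))
    λ ()
  where
  open ≡-Reasoning
  c = 11 + 10 * z + 100 * o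
  z+o+|T|≡5 : z + o + length T ≡ 5
  z+o+|T|≡5 = trans len |es|≡5
  |T|≡ : length T ≡ 5 ∸ (z + o)
  |T|≡ = trans (sym (m+n∸m≡n (z + o) (length T))) (cong (_∸ (z + o)) z+o+|T|≡5)
  z+o≤5 : z + o ≤ 5
  z+o≤5 = subst (z + o ≤_) z+o+|T|≡5 (m≤m+n (z + o) (length T))
  regroup : ∀ z o x → 11 + (z + 10 * o + 100 * x) * 10 ≡ 11 + 10 * z + 100 * o + 1000 * x
  regroup = solve-∀
  -- The shift by 3 is 2 from `splitLowPowers` and 1 from the factor 10 of m.
  a²≡ : a ^ 2 ≡ c + powersOf10 (map (3 +_) T)
  a²≡ = begin
    a ^ 2                                          ≡⟨ a²≡11+10m ⟩
    11 + m * 10                                    ≡⟨ cong (λ x → 11 + x * 10) (trans (sym es≡m) val) ⟩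
    11 + (z + 10 * o + 100 * powersOf10 T) * 10    ≡⟨ regroup z o (powersOf10 T) ⟩
    c + 1000 * powersOf10 T                        ≡⟨ cong (c +_) (powersOf10-shift 3 T) ⟨
    c + powersOf10 (map (3 +_) T)                  ∎
  c%40≡1 : c % 40 ≡ 1
  c%40≡1 = begin
    c % 40
      ≡⟨ %-remove-+ʳ c {1000 * powersOf10 T} (∣m⇒∣m*n {40} {1000} (powersOf10 T) (from-yes (40 ∣? 1000))) ⟨
    (c + 1000 * powersOf10 T) % 40 ≡⟨ cong (λ x → (c + x) % 40) (powersOf10-shift 3 T) ⟨
    (c + powersOf10 (map (3 +_) T)) % 40 ≡⟨ cong (_% 40) a²≡ ⟨
    a ^ 2 % 40 ≡⟨ a²%40≡1 ⟩
    1 ∎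
  zo∈ : (z , o) ∈ lowPowers
  zo∈ = lowPowers-complete (s≤s (m+n≤o⇒m≤o z z+o≤5)) (s≤s (m+n≤o⇒n≤o z z+o≤5)) z+o≤5 c%40≡1
  survivor : ∃[ s ] s ∈ sieve c 1 ls (replicate (length (map (3 +_) T)) 0 ∷ [])
  survivor = sieve-sound {a} a²≡ a²+16-prime a²%40≡1 ls valid (here refl) (inTrivialClass (map (3 +_) T))
  sieve≡[] : sieve c 1 ls (replicate (length (map (3 +_) T)) 0 ∷ []) ≡ []
  sieve≡[] = trans (cong (λ k → sieve c 1 ls (replicate k 0 ∷ [])) (trans (length-map (3 +_) T) |T|≡))
               (All.lookup obstructed zo∈)

-- Moduli and primes of the sieve, and its evaluation

primes : (ps : List ℕ) → {True (all? prime? ps)} → List (∃ Prime)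
primes ps {t} = All.toList (toWitness t)

-- The order of 10 modulo 23801 is 2975 = 5² · 7 · 17.
levels : List Level
levels =
    (6  ∶ primes (7 ∷ 11 ∷ 13 ∷ 37 ∷ []))
  ∷ (5  ∶ primes (31 ∷ 41 ∷ 211 ∷ 241 ∷ 271 ∷ 2161 ∷ 9091 ∷ []))
  ∷ (7  ∶ primes (43 ∷ 71 ∷ 127 ∷ 239 ∷ 1933 ∷ 2689 ∷ 4649 ∷ []))
  ∷ (2  ∶ primes (29 ∷ 61 ∷ 281 ∷ 421 ∷ 3541 ∷ []))
  ∷ (5  ∶ primes (151 ∷ 251 ∷ 601 ∷ 701 ∷ 1051 ∷ 5051 ∷ []))
  ∷ (2  ∶ primes (73 ∷ 401 ∷ 1201 ∷ []))
  ∷ (17 ∶ primes (103 ∷ 409 ∷ 613 ∷ 953 ∷ 1021 ∷ 1361 ∷ 1429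
                 ∷ 2381 ∷ 2551 ∷ 3061 ∷ 3571 ∷ 4013 ∷ 23801 ∷ []))
  ∷ []

valid : Valid 1 levels
valid = from-yes (valid? 1 levels)

-- Each `refl` runs the whole sieve for one of the four constants.
obstructed : All (Obstructed levels) lowPowers
obstructed = refl ∷ refl ∷ refl ∷ refl ∷ []

proposition4p3 : (x₁ x₂ x₃ x₄ a b : ℕ) →
    Prime x₁ → Prime x₂ → Prime x₃ → Prime x₄ →
    a > 0 → b > 0 →
    x₁ + x₂ + x₃ + x₄ ≡ a ^ 2 →
    dgs x₁ + dgs x₂ + dgs x₃ + dgs x₄ ≡ b ^ 2 →
    dgs (a ^ 2) + dgs (b ^ 2) ≡ dgs (a ^ 2 + b ^ 2) →
    Prime (a ^ 2 + b ^ 2) →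
    (∃[ s ] (s > 0 × a ^ 2 + b ^ 2 ≡ 4 * s + 1)) →
    b ≢ 4
proposition4p3 x₁ x₂ x₃ x₄ a .4 p₁ p₂ p₃ p₄ _ _ Σx≡a² Σdgs≡16 dgs-+ a²+16-prime (s , _ , a²+16≡) refl =
  square≢11+10*5powers valid obstructed {a} a²%40≡1 a²+16-prime
    (subst (λ k → IsSumOfPowers k quotients) digitSum≡5
      (+-isSumOfPowers (+-isSumOfPowers (+-isSumOfPowers
        (dgs-isSumOfPowers (x₁ / 10)) (dgs-isSumOfPowers (x₂ / 10)))
        (dgs-isSumOfPowers (x₃ / 10))) (dgs-isSumOfPowers (x₄ / 10))))
    (trans a²≡ (cong (_+ quotients * 10) units≡11))
  where
  open ≡-Reasoning
  units quotients quotientDigits : ℕ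
  units          = x₁ % 10 + x₂ % 10 + x₃ % 10 + x₄ % 10
  quotients      = x₁ / 10 + x₂ / 10 + x₃ / 10 + x₄ / 10
  quotientDigits = dgs (x₁ / 10) + dgs (x₂ / 10) + dgs (x₃ / 10) + dgs (x₄ / 10)

  a²%40≡1 : a ^ 2 % 40 ≡ 1
  a²%40≡1 = square%40≡1 a
    (begin
      a ^ 2 % 4        ≡⟨ [m+kn]%n≡m%n (a ^ 2) 4 4 ⟨
      (a ^ 2 + 16) % 4 ≡⟨ cong (_% 4) (trans a²+16≡ (trans (+-comm (4 * s) 1) (cong (1 +_) (*-comm 4 s)))) ⟩
      (1 + s * 4) % 4  ≡⟨ [m+kn]%n≡m%n 1 s 4 ⟩
      1                ∎)
    -- `dgs (4 ^ 2)` evaluates to 7.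
    (dgs-+16⇒%10≤3 (a ^ 2) dgs-+)

  a²≡ : a ^ 2 ≡ units + quotients * 10
  a²≡ = begin
    a ^ 2             ≡⟨ Σx≡a² ⟨
    x₁ + x₂ + x₃ + x₄ ≡⟨ cong₂ _+_ (cong₂ _+_ (cong₂ _+_ (split x₁) (split x₂)) (split x₃)) (split x₄) ⟩
    x₁ % 10 + x₁ / 10 * 10 + (x₂ % 10 + x₂ / 10 * 10) + (x₃ % 10 + x₃ / 10 * 10) + (x₄ % 10 + x₄ / 10 * 10)
      ≡⟨ regroup (x₁ % 10) (x₁ / 10) (x₂ % 10) (x₂ / 10) (x₃ % 10) (x₃ / 10) (x₄ % 10) (x₄ / 10) ⟩
    units + quotients * 10 ∎
    where
    split : ∀ x → x ≡ x % 10 + x / 10 * 10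
    split x = m≡m%n+[m/n]*n x 10
    regroup : ∀ a b c d e f g h →
      a + b * 10 + (c + d * 10) + (e + f * 10) + (g + h * 10) ≡ a + c + e + g + (b + d + f + h) * 10
    regroup = solve-∀

  units+quotientDigits≡16 : units + quotientDigits ≡ 16
  units+quotientDigits≡16 = begin
    units + quotientDigits
      ≡⟨ regroup (x₁ % 10) (dgs (x₁ / 10)) (x₂ % 10) (dgs (x₂ / 10))
                 (x₃ % 10) (dgs (x₃ / 10)) (x₄ % 10) (dgs (x₄ / 10)) ⟨
    x₁ % 10 + dgs (x₁ / 10) + (x₂ % 10 + dgs (x₂ / 10)) + (x₃ % 10 + dgs (x₃ / 10)) + (x₄ % 10 + dgs (x₄ / 10))
      ≡⟨ cong₂ _+_ (cong₂ _+_ (cong₂ _+_ (dgs≡%+dgs/ x₁) (dgs≡%+dgs/ x₂)) (dgs≡%+dgs/ x₃)) (dgs≡%+dgs/ x₄) ⟨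
    dgs x₁ + dgs x₂ + dgs x₃ + dgs x₄ ≡⟨ Σdgs≡16 ⟩
    16 ∎
    where
    regroup : ∀ a b c d e f g h → a + b + (c + d) + (e + f) + (g + h) ≡ a + c + e + g + (b + d + f + h)
    regroup = solve-∀

  units≡11 : units ≡ 11
  units≡11 = unitsDigits≡11 units
    (+-mono-≤ (+-mono-≤ (+-mono-≤ (unit p₁) (unit p₂)) (unit p₃)) (unit p₄))
    (subst (units ≤_) units+quotientDigits≡16 (m≤m+n units quotientDigits))
    (begin
      units % 10                    ≡⟨ [m+kn]%n≡m%n units quotients 10 ⟨
      (units + quotients * 10) % 10 ≡⟨ cong (_% 10) a²≡ ⟨
      a ^ 2 % 10                    ≡⟨ m∣n⇒o%n%m≡o%m 10 40 (a ^ 2) (from-yes (10 ∣? 40)) ⟨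
      a ^ 2 % 40 % 10               ≡⟨ cong (_% 10) a²%40≡1 ⟩
      1                             ∎)
    where
    unit : ∀ {p} → Prime p → 1 ≤ p % 10
    unit pr = n≢0⇒n>0 (prime⇒%10≢0 pr)

  digitSum≡5 : quotientDigits ≡ 5
  digitSum≡5 = +-cancelˡ-≡ 11 quotientDigits 5
    (trans (cong (_+ quotientDigits) (sym units≡11)) units+quotientDigits≡16)
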